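{- Let $G$ be a finite simple graph that contains no induced odd torch and no triangle $C_3$. Then $\chi(G)\le 3$.
   Context: A hole is an induced cycle of length at least 4; it is odd if its length is odd. An odd torch is a graph obtained from an odd hole $C$ by adding two new vertices $x,y$ and the edge $xy$, such that $x$ has no neighbor on $C$ and the set of neighbors of $y$ on $C$ is a stable set. -}

module Defs where

open import Level using (Level; _⊔_; suc)
open import Data.Nat using (ℕ; _≤_; _%_) renaming (suc to sucℕ)
open import Data.Fin using (Fin; toℕ)
open import Data.Product using (Σ; _×_; ∃; ∃-syntax; _,_)
open import Data.Sum using (_⊎_)
open import Relation.Nullary using (¬_; Dec)
open import Relation.Binary.PropositionalEquality using (_≡_; _≢_)
open import Function.Definitions using (Injective)
open import Function.Bundles using (_⇔_)

record Graph (n : ℕ) : Set₁ where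
  field
    Adj       : Fin n → Fin n → Set
    adj?      : ∀ u v → Dec (Adj u v)
    symmetric : ∀ {u v} → Adj u v → Adj v u
    irrefl    : ∀ {u} → ¬ Adj u u
open Graph public

CycAdj : (L : ℕ) → Fin L → Fin L → Set
CycAdj L i j =
    sucℕ (toℕ i) ≡ toℕ j
  ⊎ sucℕ (toℕ j) ≡ toℕ i
  ⊎ (toℕ i ≡ 0 × sucℕ (toℕ j) ≡ L)
  ⊎ (toℕ j ≡ 0 × sucℕ (toℕ i) ≡ L)

-- An odd hole of G: an induced cycle of odd length L ≥ 4 (so L ≥ 5),
-- given by an injective labelling c of its vertices in cyclic order.
record OddHole {n : ℕ} (G : Graph n) : Set where
  field
    len     : ℕ
    len≥4   : 4 ≤ len
    lenOdd  : len % 2 ≡ 1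
    c       : Fin len → Fin n
    c-inj   : Injective _≡_ _≡_ c
    induced : ∀ i j → Adj G (c i) (c j) ⇔ CycAdj len i j

-- G contains an induced odd torch: an odd hole C of G together with two
-- further vertices x, y (not on C, x ≠ y) with xy an edge, x having no
-- neighbour on C, and the neighbours of y on C forming a stable set.
-- (This is exactly an induced subgraph of G isomorphic to an odd torch.)
record InducedOddTorch {n : ℕ} (G : Graph n) : Set where
  field
    C       : OddHole G
    x y     : Fin n
  open OddHole C
  field
    x∉C     : ∀ i → c i ≢ x
    y∉C     : ∀ i → c i ≢ y
    xy      : Adj G x y
    x-noNbr : ∀ i → ¬ Adj G x (c i)
    y-stab  : ∀ i j → Adj G y (c i) → Adj G y (c j) → ¬ Adj G (c i) (c j)

HasTriangle : {n : ℕ} → Graph n → Set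
HasTriangle {n} G = ∃[ u ] ∃[ v ] ∃[ w ] (Adj G u v × Adj G v w × Adj G u w)

ProperColouring : {n : ℕ} → Graph n → (k : ℕ) → (Fin n → Fin k) → Set
ProperColouring G k col = ∀ u v → Adj G u v → col u ≢ col v

χ≤ : {n : ℕ} → Graph n → ℕ → Set
χ≤ {n} G k = ∃[ col ] ProperColouring G k col

-- Take an edge xy. As G is triangle-free, the neighbourhood of x is stable, and an odd hole C
-- among the remaining vertices (other than x) would, together with x and y, form an odd torch:
-- the neighbours of y on C are pairwise non-adjacent, again because there are no triangles.
-- So the graph H induced by the non-neighbours of x has no odd hole. In a triangle-free graph a
-- shortest odd closed walk has no repeated vertex and no chord and is not a triangle, hence is an
-- odd hole; so H has no odd closed walk and is bipartite. Colour H with 0 and 1, the neighbours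
-- of x with 2, and x itself with 0.

module Submission where

open import Data.Empty using (⊥-elim)
open import Data.Fin as Fin using (Fin; toℕ; fromℕ<; fromℕ; inject₁)
open import Data.Fin.Properties as Finₚ
  using (any?; toℕ-injective; toℕ<n; toℕ-fromℕ<; fromℕ≢inject₁; inject₁-injective)
open import Data.List using (List; []; _∷_; allFin)
open import Data.List.Membership.Propositional using (_∈_)
open import Data.List.Membership.Propositional.Properties using (∈-allFin)
open import Data.List.Relation.Unary.Any using (tail)
open import Data.Nat as ℕ using (ℕ; zero; suc; _+_; _∸_; _≤_; _<_; s≤s; z≤n; z<s; _%_; parity)
open import Data.Nat.Induction using (<-wellFounded)
open import Data.Nat.Properties
  using (+-comm; +-assoc; +-suc; <-cmp; ≤-trans; ≤-<-trans; <⇒≤; ≤∧≢⇒<; ≮⇒≥; ≤-antisym;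
         n≤1+n; m∸n≤m; ∸-monoˡ-≤; ∸-monoʳ-<; m∸n+n≡m; m+[n∸m]≡n; +-monoʳ-<)
open import Data.Parity.Base as ℙ using (Parity; 0ℙ; 1ℙ; _⁻¹)
open import Data.Parity.Properties as ℙₚ using (+-homo-+; suc-homo-⁻¹; p⁻¹+p≡1ℙ; +-cancelˡ-≡)
open import Data.Product using (Σ; ∃-syntax; _×_; _,_; proj₁; proj₂)
open import Data.Sum using (_⊎_; inj₁; inj₂; [_,_]′; map₁)
open import Function.Bundles using (Equivalence; mk⇔)
open import Function.Definitions using (Injective)
open import Induction.WellFounded using (Acc; acc)
open import Relation.Binary.Definitions using (tri<; tri≈; tri>)
open import Relation.Binary.PropositionalEquality
  using (_≡_; _≢_; refl; sym; trans; cong; subst; ≢-sym; module ≡-Reasoning)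
open import Relation.Nullary using (¬_; Dec; yes; no)
open import Relation.Nullary.Decidable using (_×-dec_; _⊎-dec_; ¬?; decidable-stable)

open import Defs

private variable
  n ℓ m : ℕ
  G : Graph n
  u v w y : Fin n

parity-suc : ∀ m → parity (suc m) ≡ parity m ⁻¹
parity-suc m = sym (suc-homo-⁻¹ (suc m))

odd-summand : ∀ a b → parity (a + b) ≡ 1ℙ → parity a ≡ 1ℙ ⊎ parity b ≡ 1ℙ
odd-summand a b odd with parity a | +-homo-+ a b
... | 1ℙ | _  = inj₁ refl
... | 0ℙ | eq = inj₂ (trans (sym eq) odd)

≢⇒+≡1ℙ : ∀ {p q : Parity} → p ≢ q → p ℙ.+ q ≡ 1ℙ
≢⇒+≡1ℙ {0ℙ} {0ℙ} p≢q = ⊥-elim (p≢q refl)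
≢⇒+≡1ℙ {0ℙ} {1ℙ} _   = refl
≢⇒+≡1ℙ {1ℙ} {0ℙ} _   = refl
≢⇒+≡1ℙ {1ℙ} {1ℙ} p≢q = ⊥-elim (p≢q refl)

toFin : Parity → Fin 2
toFin 0ℙ = Fin.zero
toFin 1ℙ = Fin.suc Fin.zero

toFin-injective : Injective _≡_ _≡_ toFin
toFin-injective {0ℙ} {0ℙ} _ = refl
toFin-injective {1ℙ} {1ℙ} _ = refl

parity≡1ℙ⇒%2≡1 : ∀ m → parity m ≡ 1ℙ → m % 2 ≡ 1
parity≡1ℙ⇒%2≡1 zero          ()
parity≡1ℙ⇒%2≡1 1             _   = refl
parity≡1ℙ⇒%2≡1 (suc (suc m)) odd = parity≡1ℙ⇒%2≡1 m odd

m∸n+[o∸m+n]≡o : ∀ {m n o} → n ≤ m → m ≤ o → (m ∸ n) + ((o ∸ m) + n) ≡ o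
m∸n+[o∸m+n]≡o {m} {n} {o} n≤m m≤o = begin
  (m ∸ n) + ((o ∸ m) + n)  ≡⟨ cong ((m ∸ n) +_) (+-comm (o ∸ m) n) ⟩
  (m ∸ n) + (n + (o ∸ m))  ≡⟨ sym (+-assoc (m ∸ n) n (o ∸ m)) ⟩
  (m ∸ n) + n + (o ∸ m)    ≡⟨ cong (_+ (o ∸ m)) (m∸n+n≡m n≤m) ⟩
  m + (o ∸ m)              ≡⟨ m+[n∸m]≡n m≤o ⟩
  o                        ∎
  where open ≡-Reasoning

o∸n+m<o : ∀ {m n o} → m < n → n ≤ o → (o ∸ n) + m < o
o∸n+m<o {m} {n} {o} m<n n≤o =
  subst ((o ∸ n) + m <_) (m∸n+n≡m n≤o) (+-monoʳ-< (o ∸ n) m<n)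

suc[n∸m]<o : ∀ {m n o} → m < n → n < o → ¬ (m ≡ 0 × suc n ≡ o) → suc (n ∸ m) < o
suc[n∸m]<o {zero}  _   n<o notWrap = ≤∧≢⇒< n<o (λ n+1≡o → notWrap (refl , n+1≡o))
suc[n∸m]<o {suc m} m<n n<o _       = ≤-<-trans (∸-monoʳ-< z<s (<⇒≤ m<n)) n<o

cycAdj? : ∀ L (i j : Fin L) → Dec (CycAdj L i j)
cycAdj? L i j =
        suc (toℕ i) ℕ.≟ toℕ j
  ⊎-dec suc (toℕ j) ℕ.≟ toℕ i
  ⊎-dec (toℕ i ℕ.≟ 0 ×-dec suc (toℕ j) ℕ.≟ L)
  ⊎-dec (toℕ j ℕ.≟ 0 ×-dec suc (toℕ i) ℕ.≟ L)

cycAdj-sym : ∀ {L} {i j : Fin L} → CycAdj L i j → CycAdj L j i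
cycAdj-sym (inj₁ i+1≡j)              = inj₂ (inj₁ i+1≡j)
cycAdj-sym (inj₂ (inj₁ j+1≡i))       = inj₁ j+1≡i
cycAdj-sym (inj₂ (inj₂ (inj₁ wrap))) = inj₂ (inj₂ (inj₂ wrap))
cycAdj-sym (inj₂ (inj₂ (inj₂ wrap))) = inj₂ (inj₂ (inj₁ wrap))

cycSuccessor : ∀ {L} (i : Fin L) → ∃[ j ] CycAdj L i j
cycSuccessor {suc L} i with suc (toℕ i) ℕ.<? suc L
... | yes i+1<L = fromℕ< i+1<L , inj₁ (sym (toℕ-fromℕ< i+1<L))
... | no  i+1≮L = Fin.zero , inj₂ (inj₂ (inj₂ (refl , ≤-antisym (toℕ<n i) (≮⇒≥ i+1≮L))))

infixr 5 _∷_ _++_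

data Walk {n : ℕ} (G : Graph n) : Fin n → Fin n → ℕ → Set where
  []  : ∀ {u} → Walk G u u 0
  _∷_ : ∀ {u v w ℓ} → Adj G u v → Walk G v w ℓ → Walk G u w (suc ℓ)

_++_ : Walk G u v ℓ → Walk G v w m → Walk G u w (ℓ + m)
[]      ++ W = W
(e ∷ V) ++ W = e ∷ (V ++ W)

reverse : Walk G u w ℓ → Walk G w u ℓ
reverse []                          = []
reverse {G = G} {ℓ = suc ℓ} (e ∷ W) =
  subst (Walk G _ _) (+-comm ℓ 1) (reverse W ++ symmetric G e ∷ [])

-- Positions past the end of a walk give its last vertex, which makes `drop` total.
at : {G : Graph n} → Walk G u w ℓ → ℕ → Fin n
at {u = u} _       zero    = u
at {u = u} []      (suc _) = u
at         (_ ∷ W) (suc k) = at W k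

at-end : (W : Walk G u w ℓ) → at W ℓ ≡ w
at-end []      = refl
at-end (_ ∷ W) = at-end W

at-step : (W : Walk G u w ℓ) {k : ℕ} → k < ℓ → Adj G (at W k) (at W (suc k))
at-step (e ∷ _) {zero}  _         = e
at-step (_ ∷ W) {suc k} (s≤s k<ℓ) = at-step W k<ℓ

take : ∀ k → k ≤ ℓ → (W : Walk G u w ℓ) → Walk G u (at W k) k
take zero    _         _       = []
take (suc k) (s≤s k≤ℓ) (e ∷ W) = e ∷ take k k≤ℓ W

drop : ∀ k (W : Walk G u w ℓ) → Walk G (at W k) w (ℓ ∸ k)
drop zero    W       = W
drop (suc k) []      = []
drop (suc k) (_ ∷ W) = drop k W

at-drop : ∀ k (W : Walk G u w ℓ) j → at (drop k W) j ≡ at W (k + j)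
at-drop zero    W       j       = refl
at-drop (suc k) []      zero    = refl
at-drop (suc k) []      (suc j) = refl
at-drop (suc k) (_ ∷ W) j       = at-drop k W j

slice : ∀ {i j} (W : Walk G u w ℓ) → i ≤ j → j ≤ ℓ → Walk G (at W i) (at W j) (j ∸ i)
slice {G = G} {i = i} {j} W i≤j j≤ℓ =
  subst (λ z → Walk G (at W i) z (j ∸ i))
        (trans (at-drop i W (j ∸ i)) (cong (at W) (m+[n∸m]≡n i≤j)))
        (take (j ∸ i) (∸-monoˡ-≤ i j≤ℓ) (drop i W))

-- Odd closed walks in triangle-free graphs contain odd holes

OddClosedWalk : Graph n → Set
OddClosedWalk G = ∃[ u ] ∃[ ℓ ] parity ℓ ≡ 1ℙ × Walk G u u ℓ

ShorterOddClosedWalk : Graph n → ℕ → Set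
ShorterOddClosedWalk G ℓ = ∃[ u ] ∃[ m ] m < ℓ × parity m ≡ 1ℙ × Walk G u u m

odd-piece : ∀ {a b} → Walk G u u a → Walk G w w b → parity (a + b) ≡ 1ℙ →
            a < ℓ → b < ℓ → ShorterOddClosedWalk G ℓ
odd-piece {a = a} {b} V W odd a<ℓ b<ℓ with odd-summand a b odd
... | inj₁ odd-a = _ , _ , a<ℓ , odd-a , V
... | inj₂ odd-b = _ , _ , b<ℓ , odd-b , W

4≤length-oddClosedWalk : ¬ HasTriangle G → (W : Walk G u u ℓ) → parity ℓ ≡ 1ℙ → 4 ≤ ℓ
4≤length-oddClosedWalk {G = G} _     (e ∷ [])            _ = ⊥-elim (irrefl G e)
4≤length-oddClosedWalk {G = G} noTri (e₁ ∷ e₂ ∷ e₃ ∷ []) _ =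
  ⊥-elim (noTri (_ , _ , _ , e₁ , e₂ , symmetric G e₃))
4≤length-oddClosedWalk _ (_ ∷ _ ∷ _ ∷ _ ∷ _) _ = s≤s (s≤s (s≤s (s≤s z≤n)))

module ClosedWalk {n ℓ : ℕ} {G : Graph n} {u : Fin n} (W : Walk G u u ℓ) where

  vertex : Fin ℓ → Fin n
  vertex i = at W (toℕ i)

  closing-adj : ∀ i j → toℕ i ≡ 0 → suc (toℕ j) ≡ ℓ → Adj G (vertex j) (vertex i)
  closing-adj i j i≡0 j+1≡ℓ =
    subst (Adj G (vertex j))
          (trans (trans (cong (at W) j+1≡ℓ) (at-end W)) (sym (cong (at W) i≡0)))
          (at-step W (toℕ<n j))

  cycAdj⇒adj : ∀ i j → CycAdj ℓ i j → Adj G (vertex i) (vertex j)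
  cycAdj⇒adj i j (inj₁ i+1≡j) =
    subst (λ k → Adj G (vertex i) (at W k)) i+1≡j (at-step W (toℕ<n i))
  cycAdj⇒adj i j (inj₂ (inj₁ j+1≡i)) =
    symmetric G (subst (λ k → Adj G (vertex j) (at W k)) j+1≡i (at-step W (toℕ<n j)))
  cycAdj⇒adj i j (inj₂ (inj₂ (inj₁ (i≡0 , j+1≡ℓ)))) = symmetric G (closing-adj i j i≡0 j+1≡ℓ)
  cycAdj⇒adj i j (inj₂ (inj₂ (inj₂ (j≡0 , i+1≡ℓ)))) = closing-adj j i j≡0 i+1≡ℓ

  Repeat : Set
  Repeat = ∃[ i ] ∃[ j ] toℕ i < toℕ j × vertex i ≡ vertex j

  Chord : Set
  Chord = ∃[ i ] ∃[ j ] Adj G (vertex i) (vertex j) × ¬ CycAdj ℓ i j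

  repeat? : Dec Repeat
  repeat? = any? λ i → any? λ j → toℕ i ℕ.<? toℕ j ×-dec vertex i Finₚ.≟ vertex j

  chord? : Dec Chord
  chord? = any? λ i → any? λ j → adj? G (vertex i) (vertex j) ×-dec ¬? (cycAdj? ℓ i j)

  vertex-injective : ¬ Repeat → Injective _≡_ _≡_ vertex
  vertex-injective noRepeat {i} {j} same with <-cmp (toℕ i) (toℕ j)
  ... | tri< i<j _ _ = ⊥-elim (noRepeat (i , j , i<j , same))
  ... | tri≈ _ i≡j _ = toℕ-injective i≡j
  ... | tri> _ _ j<i = ⊥-elim (noRepeat (j , i , j<i , sym same))

  -- Cutting at a repeated vertex leaves two closed walks of total length ℓ, cutting along a
  -- chord two of total length ℓ + 2; either way one of them is odd and both are shorter.
  repeat⇒shorter : parity ℓ ≡ 1ℙ → Repeat → ShorterOddClosedWalk G ℓ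
  repeat⇒shorter odd (i , j , i<j , same) =
    odd-piece inner outer
      (subst (λ k → parity k ≡ 1ℙ) (sym (m∸n+[o∸m+n]≡o (<⇒≤ i<j) j≤ℓ)) odd)
      (≤-<-trans (m∸n≤m (toℕ j) (toℕ i)) (toℕ<n j))
      (o∸n+m<o i<j j≤ℓ)
    where
      j≤ℓ = <⇒≤ (toℕ<n j)
      inner : Walk G (vertex j) (vertex j) (toℕ j ∸ toℕ i)
      inner = subst (λ z → Walk G z (vertex j) _) same (slice W (<⇒≤ i<j) j≤ℓ)
      outer : Walk G (vertex j) (vertex j) ((ℓ ∸ toℕ j) + toℕ i)
      outer = subst (λ z → Walk G (vertex j) z _) same
                    (drop (toℕ j) W ++ take (toℕ i) (≤-trans (<⇒≤ i<j) j≤ℓ) W)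

  chord-shortcut : parity ℓ ≡ 1ℙ → ∀ {i j} → suc i < j → j < ℓ → suc (j ∸ i) < ℓ →
                   Adj G (at W i) (at W j) → ShorterOddClosedWalk G ℓ
  chord-shortcut odd {i} {j} i+1<j j<ℓ inner<ℓ chord =
    odd-piece inner outer
      (subst (λ k → parity k ≡ 1ℙ) (sym total) odd)
      inner<ℓ
      (subst (_< ℓ) (+-suc (ℓ ∸ j) i) (o∸n+m<o i+1<j j≤ℓ))
    where
      i≤j = ≤-trans (n≤1+n i) (<⇒≤ i+1<j)
      j≤ℓ = <⇒≤ j<ℓ
      inner : Walk G (at W j) (at W j) (suc (j ∸ i))
      inner = symmetric G chord ∷ slice W i≤j j≤ℓ
      outer : Walk G (at W i) (at W i) (suc ((ℓ ∸ j) + i))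
      outer = chord ∷ drop j W ++ take i (≤-trans i≤j j≤ℓ) W
      total : suc (j ∸ i) + suc ((ℓ ∸ j) + i) ≡ 2 + ℓ
      total = cong suc (trans (+-suc (j ∸ i) _) (cong suc (m∸n+[o∸m+n]≡o i≤j j≤ℓ)))

  ordered-chord⇒shorter : parity ℓ ≡ 1ℙ → ∀ i j → toℕ i < toℕ j →
                          Adj G (vertex i) (vertex j) → ¬ CycAdj ℓ i j → ShorterOddClosedWalk G ℓ
  ordered-chord⇒shorter odd i j i<j chord ¬cyc =
    chord-shortcut odd (≤∧≢⇒< i<j (λ i+1≡j → ¬cyc (inj₁ i+1≡j))) (toℕ<n j)
      (suc[n∸m]<o i<j (toℕ<n j) (λ wrap → ¬cyc (inj₂ (inj₂ (inj₁ wrap))))) chord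

  chord⇒shorter : parity ℓ ≡ 1ℙ → Chord → ShorterOddClosedWalk G ℓ
  chord⇒shorter odd (i , j , chord , ¬cyc) with <-cmp (toℕ i) (toℕ j)
  ... | tri< i<j _ _ = ordered-chord⇒shorter odd i j i<j chord ¬cyc
  ... | tri≈ _ i≡j _ =
    ⊥-elim (irrefl G (subst (λ k → Adj G (vertex i) (at W k)) (sym i≡j) chord))
  ... | tri> _ _ j<i =
    ordered-chord⇒shorter odd j i j<i (symmetric G chord) (λ cyc → ¬cyc (cycAdj-sym cyc))

  shorter⊎oddHole : ¬ HasTriangle G → parity ℓ ≡ 1ℙ → ShorterOddClosedWalk G ℓ ⊎ OddHole G
  shorter⊎oddHole noTri odd with repeat? | chord?
  ... | yes repeat   | _           = inj₁ (repeat⇒shorter odd repeat)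
  ... | no  _        | yes chord   = inj₁ (chord⇒shorter odd chord)
  ... | no  noRepeat | no  noChord = inj₂ record
    { len     = ℓ
    ; len≥4   = 4≤length-oddClosedWalk noTri W odd
    ; lenOdd  = parity≡1ℙ⇒%2≡1 ℓ odd
    ; c       = vertex
    ; c-inj   = vertex-injective noRepeat
    ; induced = λ i j → mk⇔
        (λ adj → decidable-stable (cycAdj? ℓ i j) (λ ¬cyc → noChord (i , j , adj , ¬cyc)))
        (cycAdj⇒adj i j)
    }

oddClosedWalk⇒oddHole : ¬ HasTriangle G → OddClosedWalk G → OddHole G
oddClosedWalk⇒oddHole {G = G} noTri (_ , ℓ , odd , W) = descend (<-wellFounded ℓ) odd W
  where
    descend : ∀ {u ℓ} → Acc _<_ ℓ → parity ℓ ≡ 1ℙ → Walk G u u ℓ → OddHole G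
    descend (acc shorter) odd W with ClosedWalk.shorter⊎oddHole W noTri odd
    ... | inj₁ (_ , _ , m<ℓ , odd′ , W′) = descend (shorter m<ℓ) odd′ W′
    ... | inj₂ hole                       = hole

-- Bipartite or an odd closed walk

module _ {n : ℕ} (G : Graph n) where

  open import Data.List.Membership.DecPropositional (Finₚ._≟_ {n}) using (_∈?_)

  -- The colour of u is the parity of a walk to u from a root shared along edges, so that
  -- components can be merged by re-rooting them and a clash exhibits an odd closed walk.
  record RootedColouring (S : Fin n → Set) : Set where
    field
      root        : Fin n → Fin n
      depth       : Fin n → ℕ
      walk        : ∀ {u} → S u → Walk G (root u) u (depth u)
      root-edge   : ∀ {u w} → S u → S w → Adj G u w → root u ≡ root w
      parity-edge : ∀ {u w} → S u → S w → Adj G u w → parity (depth u) ≢ parity (depth w)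

  module Extend {xs : List (Fin n)} (R : RootedColouring (_∈ xs)) (v : Fin n) where
    open RootedColouring R

    Neighbour : Fin n → Set
    Neighbour a = a ∈ xs × Adj G v a

    neighbour? : ∀ a → Dec (Neighbour a)
    neighbour? a = a ∈? xs ×-dec adj? G v a

    Conflict : Set
    Conflict = ∃[ a ] ∃[ b ] Neighbour a × Neighbour b × root a ≡ root b ×
                             parity (depth a) ≢ parity (depth b)

    conflict? : Dec Conflict
    conflict? = any? λ a → any? λ b →
      neighbour? a ×-dec neighbour? b ×-dec root a Finₚ.≟ root b ×-dec
      ¬? (parity (depth a) ℙₚ.≟ parity (depth b))

    conflict⇒oddClosedWalk : Conflict → OddClosedWalk G
    conflict⇒oddClosedWalk (a , b , (a∈ , va) , (b∈ , vb) , same-root , differ) =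
      b , _ , trans (+-homo-+ (depth a) (depth b)) (≢⇒+≡1ℙ differ) ,
      symmetric G vb ∷ va ∷
        reverse (walk a∈) ++ subst (λ r → Walk G r b (depth b)) (sym same-root) (walk b∈)

    -- The new component consists of v and all components containing a neighbour of v; each
    -- of their vertices u is re-rooted at v through such a neighbour a, with depth
    -- 1 + depth a + depth u. Without a conflict its parity does not depend on the choice of a.
    module Merge (noConflict : ¬ Conflict) where

      agree : ∀ {a b} → Neighbour a → Neighbour b → root a ≡ root b →
              parity (depth a) ≡ parity (depth b)
      agree na nb same =
        decidable-stable (_ ℙₚ.≟ _) (λ differ → noConflict (_ , _ , na , nb , same , differ))

      Touched : Fin n → Set
      Touched r = ∃[ a ] Neighbour a × root a ≡ r

      data Status (u : Fin n) : Set where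
        new        : u ≡ v → Status u
        joined     : u ≢ v → ∀ a → Neighbour a → root a ≡ root u → Status u
        unaffected : u ≢ v → ¬ Touched (root u) → Status u

      status : ∀ u → Status u
      status u with u Finₚ.≟ v | any? (λ a → neighbour? a ×-dec root a Finₚ.≟ root u)
      ... | yes u≡v | _                   = new u≡v
      ... | no  u≢v | yes (a , na , same) = joined u≢v a na same
      ... | no  u≢v | no  untouched       = unaffected u≢v untouched

      root′ : Status u → Fin n
      root′     (new _)          = v
      root′     (joined _ _ _ _) = v
      root′ {u} (unaffected _ _) = root u

      depth′ : Status u → ℕ
      depth′     (new _)          = 0
      depth′ {u} (joined _ a _ _) = suc (depth a + depth u)
      depth′ {u} (unaffected _ _) = depth u

      walk′ : (s : Status u) → u ∈ v ∷ xs → Walk G (root′ s) u (depth′ s)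
      walk′ (new refl)                    _  = []
      walk′ (joined u≢v a (a∈ , va) same) u∈ =
        va ∷ reverse (walk a∈) ++ subst (λ r → Walk G r _ _) (sym same) (walk (tail u≢v u∈))
      walk′ (unaffected u≢v _)            u∈ = walk (tail u≢v u∈)

      joined-parity : ∀ a →
                      parity (suc (depth a + depth u)) ≡ parity (depth a) ⁻¹ ℙ.+ parity (depth u)
      joined-parity {u} a = trans (+-homo-+ (suc (depth a)) (depth u))
                                  (cong (ℙ._+ parity (depth u)) (parity-suc (depth a)))

      neighbour-touched : w ≢ v → w ∈ v ∷ xs → Adj G v w → Touched (root w)
      neighbour-touched w≢v w∈ vw = _ , (tail w≢v w∈ , vw) , refl

      touched-edge : u ≢ v → w ≢ v → u ∈ v ∷ xs → w ∈ v ∷ xs → Adj G u w →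
                     Touched (root u) → Touched (root w)
      touched-edge u≢v w≢v u∈ w∈ uw (a , na , same) =
        a , na , trans same (root-edge (tail u≢v u∈) (tail w≢v w∈) uw)

      new≢joined : ∀ {a} → w ≢ v → w ∈ v ∷ xs → Adj G v w → Neighbour a → root a ≡ root w →
                   0ℙ ≢ parity (suc (depth a + depth w))
      new≢joined {w = w} {a = a} w≢v w∈ vw na same 0ℙ≡ with begin
        0ℙ                                        ≡⟨ 0ℙ≡ ⟩
        parity (suc (depth a + depth w))          ≡⟨ joined-parity a ⟩
        parity (depth a) ⁻¹ ℙ.+ parity (depth w)  ≡⟨ cong (λ p → p ⁻¹ ℙ.+ parity (depth w))
                                                          (agree na (tail w≢v w∈ , vw) same) ⟩
        parity (depth w) ⁻¹ ℙ.+ parity (depth w)  ≡⟨ p⁻¹+p≡1ℙ (parity (depth w)) ⟩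
        1ℙ                                        ∎
        where open ≡-Reasoning
      ... | ()

      joined≢joined : ∀ {a b} → Neighbour a → Neighbour b → root a ≡ root b →
                      parity (depth u) ≢ parity (depth w) →
                      parity (suc (depth a + depth u)) ≢ parity (suc (depth b + depth w))
      joined≢joined {u} {w} {a} {b} na nb same differ eq =
        differ (+-cancelˡ-≡ (parity (depth a) ⁻¹) _ _ (begin
          parity (depth a) ⁻¹ ℙ.+ parity (depth u)  ≡⟨ joined-parity a ⟨
          parity (suc (depth a + depth u))          ≡⟨ eq ⟩
          parity (suc (depth b + depth w))          ≡⟨ joined-parity b ⟩
          parity (depth b) ⁻¹ ℙ.+ parity (depth w)  ≡⟨ cong (λ p → p ⁻¹ ℙ.+ parity (depth w))
                                                            (agree nb na (sym same)) ⟩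
          parity (depth a) ⁻¹ ℙ.+ parity (depth w)  ∎))
        where open ≡-Reasoning

      root′-edge : (su : Status u) (sw : Status w) → u ∈ v ∷ xs → w ∈ v ∷ xs → Adj G u w →
                   root′ su ≡ root′ sw
      root′-edge (new _)          (new _)          _ _ _ = refl
      root′-edge (new _)          (joined _ _ _ _) _ _ _ = refl
      root′-edge (joined _ _ _ _) (new _)          _ _ _ = refl
      root′-edge (joined _ _ _ _) (joined _ _ _ _) _ _ _ = refl
      root′-edge (new refl) (unaffected w≢v ¬t) _ w∈ vw =
        ⊥-elim (¬t (neighbour-touched w≢v w∈ vw))
      root′-edge (unaffected u≢v ¬t) (new refl) u∈ _ uv =
        ⊥-elim (¬t (neighbour-touched u≢v u∈ (symmetric G uv)))
      root′-edge (joined u≢v a na same) (unaffected w≢v ¬t) u∈ w∈ uw =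
        ⊥-elim (¬t (touched-edge u≢v w≢v u∈ w∈ uw (a , na , same)))
      root′-edge (unaffected u≢v ¬t) (joined w≢v a na same) u∈ w∈ uw =
        ⊥-elim (¬t (touched-edge w≢v u≢v w∈ u∈ (symmetric G uw) (a , na , same)))
      root′-edge (unaffected u≢v _) (unaffected w≢v _) u∈ w∈ uw =
        root-edge (tail u≢v u∈) (tail w≢v w∈) uw

      parity′-edge : (su : Status u) (sw : Status w) → u ∈ v ∷ xs → w ∈ v ∷ xs → Adj G u w →
                     parity (depth′ su) ≢ parity (depth′ sw)
      parity′-edge (new refl) (new refl) _ _ vv = ⊥-elim (irrefl G vv)
      parity′-edge (new refl) (joined w≢v a na same) _ w∈ vw = new≢joined w≢v w∈ vw na same
      parity′-edge (joined u≢v a na same) (new refl) u∈ _ uv =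
        ≢-sym (new≢joined u≢v u∈ (symmetric G uv) na same)
      parity′-edge (joined u≢v a na sa) (joined w≢v b nb sb) u∈ w∈ uw =
        joined≢joined na nb (trans sa (trans (root-edge (tail u≢v u∈) (tail w≢v w∈) uw) (sym sb)))
                      (parity-edge (tail u≢v u∈) (tail w≢v w∈) uw)
      parity′-edge (new refl) (unaffected w≢v ¬t) _ w∈ vw =
        ⊥-elim (¬t (neighbour-touched w≢v w∈ vw))
      parity′-edge (unaffected u≢v ¬t) (new refl) u∈ _ uv =
        ⊥-elim (¬t (neighbour-touched u≢v u∈ (symmetric G uv)))
      parity′-edge (joined u≢v a na same) (unaffected w≢v ¬t) u∈ w∈ uw =
        ⊥-elim (¬t (touched-edge u≢v w≢v u∈ w∈ uw (a , na , same)))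
      parity′-edge (unaffected u≢v ¬t) (joined w≢v a na same) u∈ w∈ uw =
        ⊥-elim (¬t (touched-edge w≢v u≢v w∈ u∈ (symmetric G uw) (a , na , same)))
      parity′-edge (unaffected u≢v _) (unaffected w≢v _) u∈ w∈ uw =
        parity-edge (tail u≢v u∈) (tail w≢v w∈) uw

      extended : RootedColouring (_∈ v ∷ xs)
      extended = record
        { root        = λ u → root′ (status u)
        ; depth       = λ u → depth′ (status u)
        ; walk        = λ {u} → walk′ (status u)
        ; root-edge   = λ {u} {w} → root′-edge (status u) (status w)
        ; parity-edge = λ {u} {w} → parity′-edge (status u) (status w)
        }

  extend : ∀ {xs} → RootedColouring (_∈ xs) → ∀ v → RootedColouring (_∈ v ∷ xs) ⊎ OddClosedWalk G
  extend R v with Extend.conflict? R v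
  ... | yes conflict   = inj₂ (Extend.conflict⇒oddClosedWalk R v conflict)
  ... | no  noConflict = inj₁ (Extend.Merge.extended R v noConflict)

  rootedColouring : ∀ xs → RootedColouring (_∈ xs) ⊎ OddClosedWalk G
  rootedColouring []       = inj₁ record
    { root = λ u → u ; depth = λ _ → 0 ; walk = λ () ; root-edge = λ () ; parity-edge = λ () }
  rootedColouring (v ∷ xs) = [ (λ R → extend R v) , inj₂ ]′ (rootedColouring xs)

  bipartite⊎oddClosedWalk : χ≤ G 2 ⊎ OddClosedWalk G
  bipartite⊎oddClosedWalk = map₁ colouring (rootedColouring (allFin n))
    where
      colouring : RootedColouring (_∈ allFin n) → χ≤ G 2
      colouring R = (λ u → toFin (parity (depth u))) ,
                    λ u w uw same → parity-edge (∈-allFin u) (∈-allFin w) uw (toFin-injective same)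
        where open RootedColouring R

-- Induced subgraphs and the neighbourhood of a vertex

module _ {n : ℕ} (G : Graph n) {P : Fin n → Set} (P? : ∀ u → Dec (P u)) where

  restrict : Graph n
  restrict = record
    { Adj       = λ u w → P u × P w × Adj G u w
    ; adj?      = λ u w → P? u ×-dec P? w ×-dec adj? G u w
    ; symmetric = λ (pu , pw , uw) → pw , pu , symmetric G uw
    ; irrefl    = λ (_ , _ , uu) → irrefl G uu
    }

  restrict-triangleFree : ¬ HasTriangle G → ¬ HasTriangle restrict
  restrict-triangleFree noTri (a , b , c , (_ , _ , ab) , (_ , _ , bc) , (_ , _ , ac)) =
    noTri (a , b , c , ab , bc , ac)

  oddHole-restrict : OddHole restrict → Σ (OddHole G) λ C → ∀ i → P (OddHole.c C i)
  oddHole-restrict C = record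
    { len     = len
    ; len≥4   = len≥4
    ; lenOdd  = lenOdd
    ; c       = c
    ; c-inj   = c-inj
    ; induced = λ i j → mk⇔ (λ adj → Equivalence.to (induced i j) (on-hole i , on-hole j , adj))
                            (λ cyc → proj₂ (proj₂ (Equivalence.from (induced i j) cyc)))
    } , on-hole
    where
      open OddHole C
      on-hole : ∀ i → P (c i)
      on-hole i = proj₁ (Equivalence.from (induced i _) (proj₂ (cycSuccessor i)))

module _ {n : ℕ} (G : Graph n) (x : Fin n) where

  NonNeighbour : Fin n → Set
  NonNeighbour u = u ≢ x × ¬ Adj G x u

  nonNeighbour? : ∀ u → Dec (NonNeighbour u)
  nonNeighbour? u = ¬? (u Finₚ.≟ x) ×-dec ¬? (adj? G x u)

  nonNeighbour-oddHole⇒oddTorch : ¬ HasTriangle G → Adj G x y →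
                                  OddHole (restrict G nonNeighbour?) → InducedOddTorch G
  nonNeighbour-oddHole⇒oddTorch {y = y} noTri xy hole = record
    { C       = C
    ; x       = x
    ; y       = y
    ; x∉C     = λ i → proj₁ (far i)
    ; y∉C     = λ i same → proj₂ (far i) (subst (Adj G x) (sym same) xy)
    ; xy      = xy
    ; x-noNbr = λ i → proj₂ (far i)
    ; y-stab  = λ i j yi yj ij → noTri (y , OddHole.c C i , OddHole.c C j , yi , ij , yj)
    }
    where
      C   = proj₁ (oddHole-restrict G nonNeighbour? hole)
      far = proj₂ (oddHole-restrict G nonNeighbour? hole)

  data Place (u : Fin n) : Set where
    centre    : u ≡ x → Place u
    neighbour : Adj G x u → Place u
    far       : NonNeighbour u → Place u

  place : ∀ u → Place u
  place u with u Finₚ.≟ x | adj? G x u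
  ... | yes u≡x | _      = centre u≡x
  ... | no  u≢x | yes xu = neighbour xu
  ... | no  u≢x | no ¬xu = far (u≢x , ¬xu)

  nonNeighbours-bipartite⇒χ≤3 : ¬ HasTriangle G → χ≤ (restrict G nonNeighbour?) 2 → χ≤ G 3
  nonNeighbours-bipartite⇒χ≤3 noTri (col , proper) =
    (λ u → colour (place u)) , λ u w uw → distinct (place u) (place w) uw
    where
      colour : Place u → Fin 3
      colour     (centre _)    = Fin.zero
      colour     (neighbour _) = fromℕ 2
      colour {u} (far _)       = inject₁ (col u)

      distinct : (pu : Place u) (pw : Place w) → Adj G u w → colour pu ≢ colour pw
      distinct (centre refl)   (centre refl)    uu = ⊥-elim (irrefl G uu)
      distinct (centre _)      (neighbour _)    _  = λ ()
      distinct (centre refl)   (far (_ , ¬xw))  xw = ⊥-elim (¬xw xw)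
      distinct (neighbour _)   (centre _)       _  = λ ()
      distinct (neighbour xu)  (neighbour xw)   uw = ⊥-elim (noTri (x , _ , _ , xu , uw , xw))
      distinct (neighbour _)   (far _)          _  = fromℕ≢inject₁
      distinct (far (_ , ¬xu)) (centre refl)    ux = ⊥-elim (¬xu (symmetric G ux))
      distinct (far _)         (neighbour _)    _  = ≢-sym fromℕ≢inject₁
      distinct {u} {w} (far pu) (far pw)        uw =
        λ same → proper u w (pu , pw , uw) (inject₁-injective same)

corollary1p6 : (n : ℕ) (G : Graph n) → ¬ InducedOddTorch G → ¬ HasTriangle G → χ≤ G 3
corollary1p6 n G noTorch noTri with any? (λ x → any? (λ y → adj? G x y))
... | no edgeless = (λ _ → Fin.zero) , λ u w uw _ → edgeless (u , w , uw)
... | yes (x , y , xy) with bipartite⊎oddClosedWalk (restrict G (nonNeighbour? G x))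
...   | inj₁ bipartite = nonNeighbours-bipartite⇒χ≤3 G x noTri bipartite
...   | inj₂ oddWalk   = ⊥-elim (noTorch (nonNeighbour-oddHole⇒oddTorch G x noTri xy hole))
  where
    hole = oddClosedWalk⇒oddHole (restrict-triangleFree G (nonNeighbour? G x) noTri) oddWalk
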